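{- Let $G$ be a $(k+1)$-critical hypergraph with $k\ge2$, and let $S\subseteq V(G)$ be a separating vertex set of $G$ with $|S|\le2$. Then $S=\{v,w\}$ consists of two distinct vertices, $S$ is independent in $G$ (i.e. $\{v,w\}\notin E(G)$), and $G\div S$ has exactly two components $H_1$ and $H_2$. Moreover, letting $G_i=G[V(H_i)\cup S]$ for $i\in\{1,2\}$, the notation can be chosen so that some $k$-coloring $\varphi_1$ of $G_1$ satisfies $\varphi_1(v)=\varphi_1(w)$, and then: (a) every $k$-coloring $\varphi$ of $G_1$ satisfies $\varphi(v)=\varphi(w)$, and every $k$-coloring $\varphi$ of $G_2$ satisfies $\varphi(v)\ne\varphi(w)$; (b) the hypergraph $G_1+vw$ obtained from $G_1$ by adding the ordinary edge $vw$ is $(k+1)$-critical; (c) the hypergraph obtained from $G_2$ by identifying $v$ and $w$ into a single new vertex is $(k+1)$-critical.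
   Context: A hypergraph is a pair $G=(V,E)$ of finite sets with $E\subseteq 2^V$ and $|e|\ge2$ for all $e\in E$ (no multiple edges). A $k$-coloring is a map $V(G)\to\{1,\dots,k\}$ such that every edge contains two vertices of different colors; $\chi$ is the chromatic number. $G$ is $(k+1)$-critical if $\chi(G)=k+1$ but $\chi(H)\le k$ for every proper subhypergraph $H$. For $X\subseteq V(G)$: $G[X]$ has vertex set $X$ and the edges of $G$ contained in $X$; $G(X)$ has vertex set $X$ and edge set $\{e\cap X: e\in E(G), |e\cap X|\ge2\}$; $G\div S=G(V(G)\setminus S)$. Components are maximal connected subhypergraphs (connected: any two vertices joined by a hyperpath, i.e. a sequence of distinct vertices and distinct edges with consecutive vertices in the intermediate edge). A set $S\subseteq V(G)$ is a separating vertex set if $G$ is the union of two induced subhypergraphs $G_1,G_2$ with $V(G_1)\cap V(G_2)=S$ and $|V(G_i)|>|S|$. Identifying $v$ and $w$ in $G_2$ means replacing them by a new vertex $v^*$ and replacing each edge $e$ meeting $\{v,w\}$ by $(e\setminus\{v,w\})\cup\{v^*\}$. -}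

module Defs where

open import Level using (0ℓ)
open import Data.Nat using (ℕ; suc; _≤_; _<_; _≤?_)
open import Data.Fin using (Fin; zero; suc)
open import Data.Fin.Subset
open import Data.Fin.Subset.Properties
open import Data.Vec using (_∷_; here; there)
open import Data.Vec.Properties using (≡-dec)
import Data.Bool.Properties as Bool
open import Data.List using (List; []; _∷_)
open import Data.List.Relation.Unary.Unique.Propositional using (Unique)
open import Data.Product using (∃₂; Σ-syntax; ∃-syntax; _×_; _,_; proj₁; proj₂)
open import Data.Sum using (_⊎_; inj₁; inj₂; [_,_]′)
open import Relation.Nullary using (¬_; Dec)
open import Relation.Nullary.Decidable using (does; _×-dec_; _⊎-dec_)
open import Relation.Unary using (Pred; Decidable)
open import Relation.Binary.PropositionalEquality using (_≡_; _≢_; refl; sym; subst)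

infix 4 _≟ˢ_

_≟ˢ_ : ∀ {n} (p q : Subset n) → Dec (p ≡ q)
_≟ˢ_ = ≡-dec Bool._≟_

-- The vertex set is a subset of an ambient finite set Fin n, so that
-- subhypergraphs of a hypergraph live over the same ambient set.

record Hypergraph (n : ℕ) : Set₁ where
  field
    V   : Subset n
    E   : Pred (Subset n) 0ℓ
    E?  : Decidable E
    E⊆V : ∀ {e} → E e → e ⊆ V
    2≤E : ∀ {e} → E e → 2 ≤ ∣ e ∣

open Hypergraph public

private variable
  n k : ℕ

infix 4 _⊆ᴴ_ _⊂ᴴ_ _≈ᴴ_

_⊆ᴴ_ : Hypergraph n → Hypergraph n → Set
H ⊆ᴴ G = V H ⊆ V G × (∀ {e} → E H e → E G e)

_⊂ᴴ_ : Hypergraph n → Hypergraph n → Set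
H ⊂ᴴ G = H ⊆ᴴ G × ¬ (G ⊆ᴴ H)

_≈ᴴ_ : Hypergraph n → Hypergraph n → Set
G ≈ᴴ H = G ⊆ᴴ H × H ⊆ᴴ G

Vertex : Hypergraph n → Set
Vertex G = ∃[ x ] x ∈ V G

Proper : (G : Hypergraph n) → (Vertex G → Fin k) → Set
Proper G φ = ∀ e → E G e →
  Σ[ x ∈ Vertex G ] Σ[ y ∈ Vertex G ] (proj₁ x ∈ e × proj₁ y ∈ e × φ x ≢ φ y)

Coloring : Hypergraph n → ℕ → Set
Coloring G k = Σ[ φ ∈ (Vertex G → Fin k) ] Proper G φ

-- Both relations include that v and w are vertices of G.  Proofs of x ∈ V G
-- are unique, so the choice of the membership proofs is immaterial.

SameColor : (G : Hypergraph n) → Coloring G k → Fin n → Fin n → Set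
SameColor G (φ , _) v w =
  Σ[ p ∈ v ∈ V G ] Σ[ q ∈ w ∈ V G ] φ (v , p) ≡ φ (w , q)

DifferentColors : (G : Hypergraph n) → Coloring G k → Fin n → Fin n → Set
DifferentColors G (φ , _) v w =
  Σ[ p ∈ v ∈ V G ] Σ[ q ∈ w ∈ V G ] φ (v , p) ≢ φ (w , q)

-- χ G ≐ c says that the chromatic number of G is c.

infix 4 χ_≐_

χ_≐_ : Hypergraph n → ℕ → Set
χ G ≐ c = Coloring G c × (∀ j → Coloring G j → c ≤ j)

χ_≤_ : Hypergraph n → ℕ → Set
χ G ≤ k = ∃[ c ] ((χ G ≐ c) × c ≤ k)

infix 4 χ_≤_

-- (k+1)-critical hypergraphs, indexed by k.

[_+1]-Critical : ℕ → Hypergraph n → Set₁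
[ k +1]-Critical G = (χ G ≐ suc k) × (∀ H → H ⊂ᴴ G → χ H ≤ k)

infix 8 _[_] _⟨_⟩
infixl 6 _÷_ _∪ᴴ_

-- G [ X ] and G ⟨ X ⟩ (written G(X) in the literature) are meant for X ⊆ V G.

_[_] : Hypergraph n → Subset n → Hypergraph n
G [ X ] = record
  { V   = X
  ; E   = λ e → E G e × e ⊆ X
  ; E?  = λ e → E? G e ×-dec (e ⊆? X)
  ; E⊆V = proj₂
  ; 2≤E = λ (Ge , _) → 2≤E G Ge
  }

_⟨_⟩ : Hypergraph n → Subset n → Hypergraph n
G ⟨ X ⟩ = record
  { V   = X
  ; E   = λ f → (∃[ e ] (E G e × f ≡ e ∩ X)) × 2 ≤ ∣ f ∣
  ; E?  = λ f → anySubset? (λ e → E? G e ×-dec (f ≟ˢ e ∩ X)) ×-dec (2 ≤? ∣ f ∣)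
  ; E⊆V = λ { ((e , _ , refl) , _) → p∩q⊆q e X }
  ; 2≤E = proj₂
  }

_÷_ : Hypergraph n → Subset n → Hypergraph n
G ÷ S = G ⟨ V G ─ S ⟩

_∪ᴴ_ : Hypergraph n → Hypergraph n → Hypergraph n
G ∪ᴴ H = record
  { V   = V G ∪ V H
  ; E   = λ e → E G e ⊎ E H e
  ; E?  = λ e → E? G e ⊎-dec E? H e
  ; E⊆V = λ { (inj₁ Ge) x∈e → p⊆p∪q (V H) (E⊆V G Ge x∈e)
            ; (inj₂ He) x∈e → q⊆p∪q (V G) (V H) (E⊆V H He x∈e) }
  ; 2≤E = [ 2≤E G , 2≤E H ]′
  }

2≤∣⁅v⁆∪⁅w⁆∣ : {v w : Fin n} → v ≢ w → 2 ≤ ∣ ⁅ v ⁆ ∪ ⁅ w ⁆ ∣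
2≤∣⁅v⁆∪⁅w⁆∣ {v = v} {w} v≢w =
  subst (λ m → suc m ≤ ∣ ⁅ v ⁆ ∪ ⁅ w ⁆ ∣) (∣⁅x⁆∣≡1 v)
    (p⊂q⇒∣p∣<∣q∣ ( p⊆p∪q ⁅ w ⁆
                 , w , q⊆p∪q ⁅ v ⁆ ⁅ w ⁆ (x∈⁅x⁆ w)
                 , λ w∈⁅v⁆ → v≢w (sym (x∈⁅y⁆⇒x≡y v w∈⁅v⁆))))

-- Adding the ordinary edge vw; meant for v , w ∈ V G, in which case
-- the vertex set is unchanged.

addEdge : Hypergraph n → (v w : Fin n) → v ≢ w → Hypergraph n
addEdge G v w v≢w = record
  { V   = V G ∪ (⁅ v ⁆ ∪ ⁅ w ⁆)
  ; E   = λ e → E G e ⊎ e ≡ ⁅ v ⁆ ∪ ⁅ w ⁆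
  ; E?  = λ e → E? G e ⊎-dec (e ≟ˢ ⁅ v ⁆ ∪ ⁅ w ⁆)
  ; E⊆V = λ { (inj₁ Ge) x∈e → p⊆p∪q _ (E⊆V G Ge x∈e)
            ; (inj₂ refl)   → q⊆p∪q (V G) _ }
  ; 2≤E = λ { (inj₁ Ge) → 2≤E G Ge ; (inj₂ refl) → 2≤∣⁅v⁆∪⁅w⁆∣ v≢w }
  }

-- Over Fin (suc n), zero is the new vertex v* and suc x is the old vertex x.

identifyEdge : (v w : Fin n) → Subset n → Subset (suc n)
identifyEdge v w e =
  does (nonempty? (e ∩ (⁅ v ⁆ ∪ ⁅ w ⁆))) ∷ (e ─ (⁅ v ⁆ ∪ ⁅ w ⁆))

-- The requirement 2 ≤ ∣ f ∣ discards only the image {v*} of an edge {v , w},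
-- so nothing is discarded when {v , w} is not an edge.

identify : Hypergraph n → (v w : Fin n) → Hypergraph (suc n)
identify {n} G v w = record
  { V   = inside ∷ (V G ─ (⁅ v ⁆ ∪ ⁅ w ⁆))
  ; E   = λ f → (∃[ e ] (E G e × f ≡ identifyEdge v w e)) × 2 ≤ ∣ f ∣
  ; E?  = λ f → anySubset? (λ e → E? G e ×-dec (f ≟ˢ identifyEdge v w e))
                  ×-dec (2 ≤? ∣ f ∣)
  ; E⊆V = λ { ((e , Ge , refl) , _) → image⊆V e (E⊆V G Ge) }
  ; 2≤E = proj₂
  }
  where
  ─-monoˡ : ∀ {m} {p q : Subset m} (r : Subset m) → p ⊆ q → p ─ r ⊆ q ─ r
  ─-monoˡ {p = _ ∷ _} {_ ∷ _} (inside  ∷ r) p⊆q (there i) =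
    there (─-monoˡ r (drop-∷-⊆ p⊆q) i)
  ─-monoˡ {p = _ ∷ _} {_ ∷ _} (outside ∷ r) p⊆q (there i) =
    there (─-monoˡ r (drop-∷-⊆ p⊆q) i)
  ─-monoˡ {p = inside ∷ _} {_ ∷ _} (outside ∷ r) p⊆q here with here ← p⊆q here = here

  image⊆V : ∀ e → e ⊆ V G →
            identifyEdge v w e ⊆ inside ∷ (V G ─ (⁅ v ⁆ ∪ ⁅ w ⁆))
  image⊆V e e⊆V {zero}  _         = here
  image⊆V e e⊆V {suc x} (there i) = there (─-monoˡ _ e⊆V i)

-- Walk G x y vs es: x = v₁, e₁, v₂, …, e_q, v_{q+1} = y with v_i , v_{i+1} ∈ e_i,
-- where vs and es list the v_i and the e_i.

data Walk (G : Hypergraph n) : Fin n → Fin n → List (Fin n) → List (Subset n) → Set where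
  stop : ∀ {x} → x ∈ V G → Walk G x x (x ∷ []) []
  step : ∀ {x y z e vs es} → E G e → x ∈ e → y ∈ e →
         Walk G y z vs es → Walk G x z (x ∷ vs) (e ∷ es)

Hyperpath : Hypergraph n → Fin n → Fin n → Set
Hyperpath G x y = ∃₂ λ vs es → Walk G x y vs es × Unique vs × Unique es

Connected : Hypergraph n → Set
Connected G = ∀ {x y} → x ∈ V G → y ∈ V G → Hyperpath G x y

IsComponent : Hypergraph n → Hypergraph n → Set₁
IsComponent G H = H ⊆ᴴ G × Connected H ×
  (∀ H′ → H′ ⊆ᴴ G → Connected H′ → H ⊆ᴴ H′ → H′ ⊆ᴴ H)

HasExactlyComponents : (G H₁ H₂ : Hypergraph n) → Set₁
HasExactlyComponents G H₁ H₂ =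
  IsComponent G H₁ × IsComponent G H₂ × ¬ (H₁ ≈ᴴ H₂) ×
  (∀ H → IsComponent G H → H ≈ᴴ H₁ ⊎ H ≈ᴴ H₂)

IsSeparating : Hypergraph n → Subset n → Set
IsSeparating G S = ∃₂ λ X₁ X₂ →
  X₁ ⊆ V G × X₂ ⊆ V G × G ≈ᴴ G [ X₁ ] ∪ᴴ G [ X₂ ] × X₁ ∩ X₂ ≡ S ×
  ∣ S ∣ < ∣ X₁ ∣ × ∣ S ∣ < ∣ X₂ ∣

{-# OPTIONS --safe #-}
module Submission where

-- Every side of S has a k-coloring, because it is a proper subhypergraph, but
-- after permuting colors on one side no two such colorings may agree on S,
-- since they would then combine to a k-coloring of G.  With |S| ≤ 1 they always
-- can be made to agree; with S = {v, w} all that matters is whether v and w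
-- have the same color, so on one side they always do and on the other they
-- never do.  A proper subhypergraph of G₁ + vw or of G₂ with v and w identified
-- becomes a proper subhypergraph of G once vw is replaced by G₂, respectively
-- the new vertex by G₁.

open import Defs
open import Level using (0ℓ)
open import Data.Nat using (ℕ; zero; suc; _≤_; _<_; s≤s)
open import Data.Nat.Properties
  using (≤-refl; ≤-trans; <-irrefl; <⇒≤; <-≤-trans; ≮⇒≥; ≰⇒>; anyUpTo?)
open import Data.Nat.Induction using (<-wellFounded)
open import Data.Fin using (Fin; zero; suc; inject≤; finToFun; funToFin)
open import Data.Fin.Properties
  using (_≟_; any?; ¬Fin0; 0≢1+n; suc-injective; inject≤-injective; finToFun-funToFin)
open import Data.Fin.Permutation.Components using (transpose; transpose-inverse)
open import Data.Fin.Subset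
open import Data.Fin.Subset.Properties
open import Data.Fin.Subset.Induction using (⊃-wellFounded)
open import Data.Vec using (_∷_; here; there; tail)
open import Data.Vec.Properties.WithK using ([]=-irrelevant)
open import Data.List.Relation.Unary.All as All using (All; []; _∷_)
open import Data.List.Relation.Unary.AllPairs using ([]; _∷_)
open import Data.List.Relation.Unary.Unique.Propositional using (Unique)
open import Data.Empty using (⊥-elim)
open import Data.Product using (∃₂; ∃-syntax; Σ-syntax; _×_; _,_; proj₁; proj₂)
open import Data.Sum as Sum using (_⊎_; inj₁; inj₂; [_,_]′; swap)
open import Function using (_∘_; _⇔_; mk⇔; Equivalence)
open import Induction.WellFounded using (Acc; acc)
open import Relation.Nullary using (¬_; Dec; yes; no; contradiction)
open import Relation.Nullary.Decidable
  using (¬?; _×-dec_; _⊎-dec_; map′; decidable-stable; dec-true; dec-false)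
open import Relation.Unary using (Pred; Decidable)
open import Relation.Binary.PropositionalEquality
  using (_≡_; _≢_; refl; sym; trans; cong; subst; subst₂)

private variable
  n k m : ℕ
  u v w x y : Fin n
  e p q : Subset n

-- Finite sets with few elements

x∈p─q⇒x∉q : x ∈ p ─ q → x ∉ q
x∈p─q⇒x∉q {p = _ ∷ p} {inside  ∷ q} (there x∈) (there x∈q) = x∈p─q⇒x∉q {p = p} x∈ x∈q
x∈p─q⇒x∉q {p = _ ∷ p} {outside ∷ q} (there x∈) (there x∈q) = x∈p─q⇒x∉q {p = p} x∈ x∈q

x∈p─q⇒x∈p : x ∈ p ─ q → x ∈ p
x∈p─q⇒x∈p {p = p} {q} = p─q⊆p p q

v∈⁅v,w⁆ : v ∈ ⁅ v ⁆ ∪ ⁅ w ⁆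
v∈⁅v,w⁆ {v = v} = p⊆p∪q _ (x∈⁅x⁆ v)

w∈⁅v,w⁆ : w ∈ ⁅ v ⁆ ∪ ⁅ w ⁆
w∈⁅v,w⁆ {w = w} = q⊆p∪q _ _ (x∈⁅x⁆ w)

∈⁅v,w⁆⇒≡ : x ∈ ⁅ v ⁆ ∪ ⁅ w ⁆ → x ≡ v ⊎ x ≡ w
∈⁅v,w⁆⇒≡ {v = v} {w} x∈ with x∈p∪q⁻ ⁅ v ⁆ ⁅ w ⁆ x∈
... | inj₁ x∈v = inj₁ (x∈⁅y⁆⇒x≡y v x∈v)
... | inj₂ x∈w = inj₂ (x∈⁅y⁆⇒x≡y w x∈w)

⁅v,w⁆⊆ : v ∈ p → w ∈ p → ⁅ v ⁆ ∪ ⁅ w ⁆ ⊆ p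
⁅v,w⁆⊆ v∈p w∈p x∈ with ∈⁅v,w⁆⇒≡ x∈
... | inj₁ refl = v∈p
... | inj₂ refl = w∈p

⊈⇒∃ : ¬ p ⊆ q → ∃[ x ] (x ∈ p × x ∉ q)
⊈⇒∃ {p = p} {q} p⊈q with any? (λ x → x ∈? p ×-dec ¬? (x ∈? q))
... | yes found = found
... | no ¬found = contradiction
  (λ {x} x∈p → decidable-stable (x ∈? q) λ x∉q → ¬found (x , x∈p , x∉q)) p⊈q

∣p∣<∣q∣⇒∃ : ∣ p ∣ < ∣ q ∣ → ∃[ x ] (x ∈ q × x ∉ p)
∣p∣<∣q∣⇒∃ p<q = ⊈⇒∃ λ q⊆p → <-irrefl refl (<-≤-trans p<q (p⊆q⇒∣p∣≤∣q∣ q⊆p))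

∃-other : 2 ≤ ∣ e ∣ → ∀ x → ∃[ y ] (y ∈ e × y ≢ x)
∃-other {e = e} 2≤e x with ∣p∣<∣q∣⇒∃ (subst (_< ∣ e ∣) (sym (∣⁅x⁆∣≡1 x)) 2≤e)
... | y , y∈e , y∉x = y , y∈e , x∉⁅y⁆⇒x≢y y∉x

distinct⇒2≤ : x ∈ e → y ∈ e → x ≢ y → 2 ≤ ∣ e ∣
distinct⇒2≤ x∈e y∈e x≢y = ≤-trans (2≤∣⁅v⁆∪⁅w⁆∣ x≢y) (p⊆q⇒∣p∣≤∣q∣ (⁅v,w⁆⊆ x∈e y∈e))

⊆pair⇒≡ : 2 ≤ ∣ e ∣ → e ⊆ ⁅ v ⁆ ∪ ⁅ w ⁆ → e ≡ ⁅ v ⁆ ∪ ⁅ w ⁆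
⊆pair⇒≡ {e = e} {v} {w} 2≤e e⊆ = ⊆-antisym e⊆ (⁅v,w⁆⊆ v∈e w∈e)
  where
  v∈e : v ∈ e
  v∈e with ∃-other 2≤e w
  ... | y , y∈e , y≢w with ∈⁅v,w⁆⇒≡ (e⊆ y∈e)
  ... | inj₁ refl = y∈e
  ... | inj₂ y≡w  = contradiction y≡w y≢w
  w∈e : w ∈ e
  w∈e with ∃-other 2≤e v
  ... | y , y∈e , y≢v with ∈⁅v,w⁆⇒≡ (e⊆ y∈e)
  ... | inj₁ y≡v  = contradiction y≡v y≢v
  ... | inj₂ refl = y∈e

-- The vertex u only supplies a value of v when p is empty.
∣p∣≤2-cases : Fin n → (p : Subset n) → ∣ p ∣ ≤ 2 →
  (∃[ v ] p ⊆ ⁅ v ⁆ ∪ ⁅ v ⁆) ⊎ (∃₂ λ v w → v ≢ w × p ≡ ⁅ v ⁆ ∪ ⁅ w ⁆)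
∣p∣≤2-cases u p p≤2 with nonempty? p
... | no ¬v = inj₁ (u , λ x∈p → contradiction (_ , x∈p) ¬v)
... | yes (v , v∈p) with nonempty? (p - v)
...   | no ¬w = inj₁ (v , p⊆v)
  where
  p⊆v : p ⊆ ⁅ v ⁆ ∪ ⁅ v ⁆
  p⊆v {x} x∈p with x ≟ v
  ... | yes refl = v∈⁅v,w⁆
  ... | no x≢v   = contradiction (x , x∈p∧x≢y⇒x∈p-y x∈p x≢v) ¬w
...   | yes (w , w∈p-v) = inj₂ (v , w , v≢w , ⊆-antisym p⊆ ⊆p)
  where
  v≢w : v ≢ w
  v≢w refl = x∈p─q⇒x∉q {p = p} w∈p-v (x∈⁅x⁆ v)
  ⊆p : ⁅ v ⁆ ∪ ⁅ w ⁆ ⊆ p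
  ⊆p = ⁅v,w⁆⊆ v∈p (x∈p─q⇒x∈p w∈p-v)
  p⊆ : p ⊆ ⁅ v ⁆ ∪ ⁅ w ⁆
  p⊆ {x} x∈p with x ∈? ⁅ v ⁆ ∪ ⁅ w ⁆
  ... | yes x∈ = x∈
  -- Otherwise `v`, `w` and `x` would be three elements of `p`.
  ... | no x∉  = contradiction
    (≤-trans (s≤s (2≤∣⁅v⁆∪⁅w⁆∣ v≢w)) (≤-trans (p⊂q⇒∣p∣<∣q∣ (⊆p , x , x∈p , x∉)) p≤2))
    (<-irrefl refl)

-- Colorings, the chromatic number and criticality

-- Colorings are handled as maps on the whole ambient set, which is harmless
-- as soon as there is at least one color.

Polychromatic : (Fin n → Fin k) → Subset n → Set
Polychromatic f e = ∃₂ λ x y → x ∈ e × y ∈ e × f x ≢ f y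

Colors : Hypergraph n → (Fin n → Fin k) → Set
Colors G f = ∀ e → E G e → Polychromatic f e

Colorable : Hypergraph n → ℕ → Set
Colorable {n} G k = Σ[ f ∈ (Fin n → Fin k) ] Colors G f

Polychromatic-resp : {f : Fin n → Fin k} {g : Fin n → Fin m} →
  (∀ {x y} → x ∈ e → y ∈ e → f x ≢ f y → g x ≢ g y) →
  Polychromatic f e → Polychromatic g e
Polychromatic-resp f⇒g (x , y , x∈e , y∈e , fx≢fy) =
  x , y , x∈e , y∈e , f⇒g x∈e y∈e fx≢fy

Polychromatic-≗ : {f g : Fin n → Fin k} → (∀ {x} → x ∈ e → f x ≡ g x) →
  Polychromatic f e → Polychromatic g e
Polychromatic-≗ f≗g =
  Polychromatic-resp λ x∈e y∈e → subst₂ _≢_ (f≗g x∈e) (f≗g y∈e)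

polychromatic? : (f : Fin n → Fin k) → Decidable (Polychromatic f)
polychromatic? f e =
  any? λ x → any? λ y → x ∈? e ×-dec y ∈? e ×-dec ¬? (f x ≟ f y)

colors? : (G : Hypergraph n) (f : Fin n → Fin k) → Dec (Colors G f)
colors? G f = map′
  (λ ¬bad e Ge → decidable-stable (polychromatic? f e) λ ¬p → ¬bad (e , Ge , ¬p))
  (λ c (e , Ge , ¬p) → ¬p (c e Ge))
  (¬? (anySubset? λ e → E? G e ×-dec ¬? (polychromatic? f e)))

-- The maps `Fin n → Fin k` are coded by the elements of `Fin (k ^ n)`, so the search is finite.
-- Decoding a code returns the map only pointwise, which is enough for the edges.
colorable? : (G : Hypergraph n) (k : ℕ) → Dec (Colorable G k)
colorable? {n} G k = map′
  (λ (c , colors) → finToFun c , colors)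
  (λ (f , colors) → funToFin f ,
    λ e Ge → Polychromatic-≗ (λ {x} _ → sym (finToFun-funToFin f x)) (colors e Ge))
  (any? λ c → colors? G (finToFun {k} {n} c))

extend : (G : Hypergraph n) → (Vertex G → Fin (suc m)) → Fin n → Fin (suc m)
extend G φ x with x ∈? V G
... | yes x∈V = φ (x , x∈V)
-- The value is arbitrary, as every edge lies within `V G`.
... | no _    = zero

extend-≡ : (G : Hypergraph n) (φ : Vertex G → Fin (suc m)) (x∈V : x ∈ V G) →
  extend G φ x ≡ φ (x , x∈V)
extend-≡ {x = x} G φ x∈V with x ∈? V G
... | yes x∈V′ = cong (λ i → φ (x , i)) ([]=-irrelevant x∈V′ x∈V)
... | no x∉V   = contradiction x∈V x∉V

extend-colors : (G : Hypergraph n) (φ : Coloring G (suc m)) → Colors G (extend G (proj₁ φ))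
extend-colors G (φ , proper) e Ge with proper e Ge
... | (x , x∈V) , (y , y∈V) , x∈e , y∈e , φx≢φy = x , y , x∈e , y∈e ,
  subst₂ _≢_ (sym (extend-≡ G φ x∈V)) (sym (extend-≡ G φ y∈V)) φx≢φy

coloring⇒colorable : (G : Hypergraph n) → Coloring G (suc m) → Colorable G (suc m)
coloring⇒colorable G φ = extend G (proj₁ φ) , extend-colors G φ

colorable⇒coloring : (G : Hypergraph n) → Colorable G k → Coloring G k
colorable⇒coloring G (f , colors) = f ∘ proj₁ , λ e Ge →
  let x , y , x∈e , y∈e , fx≢fy = colors e Ge
  in (x , E⊆V G Ge x∈e) , (y , E⊆V G Ge y∈e) , x∈e , y∈e , fx≢fy

coloring-mono : (G : Hypergraph n) → k ≤ m → Coloring G k → Coloring G m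
coloring-mono G k≤m (φ , proper) = (λ x → inject≤ (φ x) k≤m) , λ e Ge →
  let x , y , x∈e , y∈e , φx≢φy = proper e Ge
  in x , y , x∈e , y∈e , φx≢φy ∘ inject≤-injective k≤m k≤m (φ x) (φ y)

coloring? : (G : Hypergraph n) (k : ℕ) → Dec (Coloring G k)
coloring? {n} G zero with nonempty? (V G)
... | yes vertex = no λ (φ , _) → ¬Fin0 (φ vertex)
-- Without vertices there are no edges either, since an edge has at least two elements.
... | no ¬vertex = yes ((λ x → contradiction x ¬vertex) , λ e Ge →
  let x , x∈e , _ = ∣p∣<∣q∣⇒∃ {p = ⊥} (subst (_< ∣ e ∣) (sym (∣⊥∣≡0 n)) (<⇒≤ (2≤E G Ge)))
  in contradiction (x , E⊆V G Ge x∈e) ¬vertex)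
coloring? G (suc k) = map′ (colorable⇒coloring G)
  (coloring⇒colorable G) (colorable? G (suc k))

-- Supplies the chromatic number whose existence is part of `χ G ≤ k`: while a smaller number
-- satisfies `P`, the search moves down to it.
least : {P : Pred ℕ 0ℓ} → Decidable P → P k →
  ∃[ c ] ((P c × ∀ j → P j → c ≤ j) × c ≤ k)
least {P = P} P? = go (<-wellFounded _)
  where
  go : ∀ {k} → Acc _<_ k → P k → ∃[ c ] ((P c × ∀ j → P j → c ≤ j) × c ≤ k)
  go {k} (acc rs) Pk with anyUpTo? P? k
  ... | yes (j , j<k , Pj) with go (rs j<k) Pj
  ...   | c , c-least , c≤j = c , c-least , ≤-trans c≤j (<⇒≤ j<k)
  go {k} (acc rs) Pk | no ¬smaller =
    k , (Pk , λ j Pj → ≮⇒≥ λ j<k → ¬smaller (j , j<k , Pj)) , ≤-refl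

colorable⇒χ≤ : (G : Hypergraph n) → Colorable G k → χ G ≤ k
colorable⇒χ≤ G c = least (coloring? G) (colorable⇒coloring G c)

χ≤⇒colorable : (G : Hypergraph n) → χ G ≤ suc m → Colorable G (suc m)
χ≤⇒colorable G (c , (φ , _) , c≤k) = coloring⇒colorable G (coloring-mono G c≤k φ)

-- For the lower bound on the chromatic number it is enough to exclude `suc m` colors, because a
-- coloring with fewer colors is also one with `suc m`.
critical : (G : Hypergraph n) → Colorable G (suc (suc m)) → ¬ Colorable G (suc m) →
  (∀ H → H ⊂ᴴ G → Colorable H (suc m)) → [ suc m +1]-Critical G
critical G colorable ¬colorable sub =
  (colorable⇒coloring G colorable , λ j φ → ≰⇒> λ j≤k →
    ¬colorable (coloring⇒colorable G (coloring-mono G j≤k φ))) ,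
  λ H H⊂G → colorable⇒χ≤ H (sub H H⊂G)

critical⇒¬colorable : (G : Hypergraph n) → [ k +1]-Critical G → ¬ Colorable G k
critical⇒¬colorable G ((_ , minimal) , _) c =
  <-irrefl refl (minimal _ (colorable⇒coloring G c))

critical⇒sub-colorable : (G : Hypergraph n) → [ suc m +1]-Critical G →
  ∀ H → H ⊂ᴴ G → Colorable H (suc m)
critical⇒sub-colorable G (_ , sub) H H⊂G = χ≤⇒colorable H (sub H H⊂G)

-- A new color for v suffices, as every edge through v has a second vertex.
colorable-suc : (G : Hypergraph n) (v : Fin n) (f : Fin n → Fin k) →
  (∀ e → E G e → v ∉ e → Polychromatic f e) → Colorable G (suc k)
colorable-suc {n} {k} G v f colors = h , h-colors
  where
  h : Fin n → Fin (suc k)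
  h x with x ≟ v
  ... | yes _ = zero
  ... | no _  = suc (f x)

  h-v : h v ≡ zero
  h-v with v ≟ v
  ... | yes _  = refl
  ... | no v≢v = contradiction refl v≢v

  h-other : x ≢ v → h x ≡ suc (f x)
  h-other {x} x≢v with x ≟ v
  ... | yes x≡v = contradiction x≡v x≢v
  ... | no _    = refl

  h-colors : Colors G h
  h-colors e Ge with v ∈? e
  ... | yes v∈e with ∃-other (2≤E G Ge) v
  ...   | y , y∈e , y≢v = v , y , v∈e , y∈e ,
    λ hv≡hy → 0≢1+n (trans (sym h-v) (trans hv≡hy (h-other y≢v)))
  h-colors e Ge | no v∉e = Polychromatic-resp
    (λ x∈e y∈e fx≢fy hx≡hy → fx≢fy (suc-injective
      (trans (sym (h-other (∈⇒≢ x∈e))) (trans hx≡hy (h-other (∈⇒≢ y∈e))))))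
    (colors e Ge v∉e)
    where
    ∈⇒≢ : x ∈ e → x ≢ v
    ∈⇒≢ x∈e refl = v∉e x∈e

-- Permuting colors and merging two colorings

transpose-i : (i j : Fin n) → transpose i j i ≡ j
transpose-i i j rewrite dec-true (i ≟ i) refl = refl

transpose-fixed : (i j : Fin n) → x ≢ i → x ≢ j → transpose i j x ≡ x
transpose-fixed {x = x} i j x≢i x≢j
  rewrite dec-false (x ≟ i) x≢i | dec-false (x ≟ j) x≢j = refl

transpose-injective : (i j : Fin n) → transpose i j x ≡ transpose i j y → x ≡ y
transpose-injective i j eq =
  trans (sym (transpose-inverse j i)) (trans (cong (transpose j i) eq) (transpose-inverse j i))

-- One transposition of colors carries `g v` to `f v`. If `f` identifies `v` and `w`, then so does
-- `g`, and `w` comes along; otherwise a second transposition corrects the color of `w`.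
realign : {f g : Fin n → Fin k} → f v ≡ f w ⇔ g v ≡ g w →
  Σ[ h ∈ (Fin n → Fin k) ]
    ((∀ {x y} → g x ≢ g y → h x ≢ h y) × h v ≡ f v × h w ≡ f w)
realign {n} {k} {v} {w} {f} {g} f⇔g = result
  where
  h₁ : Fin n → Fin k
  h₁ = transpose (g v) (f v) ∘ g

  h₁v≡fv : h₁ v ≡ f v
  h₁v≡fv = transpose-i (g v) (f v)

  h₁-≢ : ∀ {x y} → g x ≢ g y → h₁ x ≢ h₁ y
  h₁-≢ gx≢gy = gx≢gy ∘ transpose-injective (g v) (f v)

  result : Σ[ h ∈ (Fin n → Fin k) ]
    ((∀ {x y} → g x ≢ g y → h x ≢ h y) × h v ≡ f v × h w ≡ f w)
  result with f v ≟ f w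
  ... | yes fv≡fw = h₁ , h₁-≢ , h₁v≡fv ,
    trans (cong (transpose (g v) (f v)) (sym (Equivalence.to f⇔g fv≡fw))) (trans h₁v≡fv fv≡fw)
  ... | no fv≢fw =
    transpose (h₁ w) (f w) ∘ h₁ ,
    (λ gx≢gy → h₁-≢ gx≢gy ∘ transpose-injective (h₁ w) (f w)) ,
    -- The second transposition does not disturb `v`: its color `f v` differs from `h₁ w`, because
    -- `g` separates `v` and `w`, and from `f w`, because `f` does.
    trans (transpose-fixed (h₁ w) (f w)
            (h₁-≢ (fv≢fw ∘ Equivalence.from f⇔g))
            (subst (_≢ f w) (sym h₁v≡fv) fv≢fw))
          h₁v≡fv ,
    transpose-i (h₁ w) (f w)

-- After a permutation of its colors `g` agrees with `f` at `v` and `w`. It is then used on `D`, and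
-- `f` elsewhere, so that each edge sees only one of the two. The choice is made edge by edge, so
-- neither map has to color all of `G`.
merge : (G : Hypergraph n) (D : Subset n) {f g : Fin n → Fin k} → f v ≡ f w ⇔ g v ≡ g w →
  (∀ e → E G e →
    ((∀ {x} → x ∈ e → x ∉ D) × Polychromatic f e) ⊎
    ((∀ {x} → x ∈ e → x ∈ D ⊎ x ∈ ⁅ v ⁆ ∪ ⁅ w ⁆) × Polychromatic g e)) →
  Colorable G k
merge {n} {k} {v} {w} G D {f} {g} f⇔g colors with realign {f = f} {g} f⇔g
... | g′ , g′-≢ , g′v≡fv , g′w≡fw = h , h-colors
  where
  h : Fin n → Fin k
  h x with x ∈? D
  ... | yes _ = g′ x
  ... | no _  = f x

  h≡f : x ∉ D → h x ≡ f x
  h≡f {x} x∉D with x ∈? D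
  ... | yes x∈D = contradiction x∈D x∉D
  ... | no _    = refl

  h≡g′ : x ∈ D ⊎ x ∈ ⁅ v ⁆ ∪ ⁅ w ⁆ → h x ≡ g′ x
  h≡g′ {x} x∈ with x ∈? D
  ... | yes _   = refl
  ... | no x∉D with x∈
  ...   | inj₁ x∈D = contradiction x∈D x∉D
  ...   | inj₂ x∈vw with ∈⁅v,w⁆⇒≡ x∈vw
  ...     | inj₁ refl = sym g′v≡fv
  ...     | inj₂ refl = sym g′w≡fw

  h-colors : Colors G h
  h-colors e Ge with colors e Ge
  ... | inj₁ (e∉D , poly) = Polychromatic-≗ (λ x∈e → sym (h≡f (e∉D x∈e))) poly
  ... | inj₂ (e∈D , poly) = Polychromatic-≗ (λ x∈e → sym (h≡g′ (e∈D x∈e)))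
    (Polychromatic-resp (λ _ _ → g′-≢) poly)

-- Hyperpaths and connectedness

Closed : Hypergraph n → Subset n → Set
Closed G C = ∀ e → E G e → Nonempty (e ∩ C) → e ⊆ C

PathWithin : Hypergraph n → Subset n → Fin n → Fin n → Set
PathWithin G C x y = ∃₂ λ vs es →
  Walk G x y vs es × Unique vs × Unique es × All (_∈ C) vs × All (_⊆ C) es

-- An edge e meeting C but not contained in C differs from all edges of the
-- paths inside C, so prepending e to such a path gives a path inside C ∪ e.
grow : (G : Hypergraph n) (C : Subset n) → Acc _⊃_ C → y ∈ C →
  (∀ {x} → x ∈ C → PathWithin G C x y) →
  ∃[ C′ ] (Closed G C′ × y ∈ C′ × (∀ {x} → x ∈ C′ → PathWithin G C′ x y))
grow G C (acc rs) y∈C paths with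
  anySubset? (λ e → E? G e ×-dec nonempty? (e ∩ C) ×-dec ¬? (e ⊆? C))
... | no ¬leaving = C ,
  (λ e Ge meets → decidable-stable (e ⊆? C) λ e⊈C → ¬leaving (e , Ge , meets , e⊈C)) ,
  y∈C , paths
... | yes (e , Ge , (u , u∈e∩C) , e⊈C) with x∈p∩q⁻ e C u∈e∩C | ⊈⇒∃ e⊈C
...   | u∈e , u∈C | z , z∈e , z∉C =
  grow G (C ∪ e) (rs (C⊆ , z , e⊆ z∈e , z∉C)) (C⊆ y∈C) paths′
  where
  C⊆ : C ⊆ C ∪ e
  C⊆ = p⊆p∪q e
  e⊆ : e ⊆ C ∪ e
  e⊆ = q⊆p∪q C e
  weaken : ∀ {x} → PathWithin G C x _ → PathWithin G (C ∪ e) x _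
  weaken (vs , es , walk , vs! , es! , vs∈ , es⊆) =
    vs , es , walk , vs! , es! , All.map C⊆ vs∈ ,
    All.map {P = _⊆ C} {Q = _⊆ C ∪ e} (λ f⊆C x∈f → C⊆ (f⊆C x∈f)) es⊆
  paths′ : ∀ {x} → x ∈ C ∪ e → PathWithin G (C ∪ e) x _
  paths′ {x} x∈ with x ∈? C
  ... | yes x∈C = weaken (paths x∈C)
  ... | no x∉C with x∈p∪q⁻ C e x∈ | paths u∈C
  ...   | inj₁ x∈C | _ = contradiction x∈C x∉C
  ...   | inj₂ x∈e | path@(_ , _ , walk , vs! , es! , vs∈ , es⊆) =
    let _ , _ , _ , _ , _ , vs∈′ , es⊆′ = weaken path in
    _ , _ , step Ge x∈e u∈e walk ,
    All.map (λ v∈C x≡v → x∉C (subst (_∈ C) (sym x≡v) v∈C)) vs∈ ∷ vs! ,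
    All.map {P = _⊆ C} {Q = e ≢_} (λ f⊆C e≡f → e⊈C (subst (_⊆ C) (sym e≡f) f⊆C)) es⊆ ∷ es! ,
    x∈ ∷ vs∈′ , e⊆ ∷ es⊆′

-- Growing the set of `y` alone until no edge leaves it gives a closed set whose elements all have a
-- hyperpath to `y`, and by hypothesis it contains every vertex. Connectedness thus reduces to
-- showing that no closed set splits `V G`.
connected : (G : Hypergraph n) →
  (∀ C {y} → Closed G C → y ∈ V G → y ∈ C → V G ⊆ C) → Connected G
connected G closed⇒⊇ {x} {y} x∈V y∈V =
  let C , closed , y∈C , paths = grow G ⁅ y ⁆ (⊃-wellFounded ⁅ y ⁆) (x∈⁅x⁆ y) trivial-path
      vs , es , walk , vs! , es! , _ = paths (closed⇒⊇ C closed y∈V y∈C x∈V)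
  in vs , es , walk , vs! , es!
  where
  trivial-path : ∀ {x} → x ∈ ⁅ y ⁆ → PathWithin G ⁅ y ⁆ x y
  trivial-path x∈ with refl ← x∈⁅y⁆⇒x≡y y x∈ =
    _ , _ , stop y∈V , [] ∷ [] , [] , x∈⁅x⁆ y ∷ [] , []

-- Identifying two vertices

collapse : (v w : Fin n) → Fin n → Fin (suc n)
collapse v w x with x ∈? ⁅ v ⁆ ∪ ⁅ w ⁆
... | yes _ = zero
... | no _  = suc x

collapse-∈ : x ∈ ⁅ v ⁆ ∪ ⁅ w ⁆ → collapse v w x ≡ zero
collapse-∈ {x = x} {v} {w} x∈ with x ∈? ⁅ v ⁆ ∪ ⁅ w ⁆
... | yes _ = refl
... | no x∉ = contradiction x∈ x∉

collapse-∉ : x ∉ ⁅ v ⁆ ∪ ⁅ w ⁆ → collapse v w x ≡ suc x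
collapse-∉ {x = x} {v} {w} x∉ with x ∈? ⁅ v ⁆ ∪ ⁅ w ⁆
... | yes x∈ = contradiction x∈ x∉
... | no _   = refl

-- With the converse below, this makes `identifyEdge v w e` the image of `e` under the quotient map
-- `collapse v w`, along which colorings are pulled back.
∈-identifyEdge⁺ : x ∈ e → collapse v w x ∈ identifyEdge v w e
∈-identifyEdge⁺ {x = x} {e} {v} {w} x∈e with x ∈? ⁅ v ⁆ ∪ ⁅ w ⁆
... | no x∉ = there (x∈p∧x∉q⇒x∈p─q x∈e x∉)
... | yes x∈ with nonempty? (e ∩ (⁅ v ⁆ ∪ ⁅ w ⁆))
...   | yes _     = here
...   | no ¬meets = contradiction (x , x∈p∩q⁺ (x∈e , x∈)) ¬meets

∈-identifyEdge⁻ : ∀ y → y ∈ identifyEdge v w e → ∃[ x ] (x ∈ e × collapse v w x ≡ y)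
∈-identifyEdge⁻ {v = v} {w} {e} zero y∈ with nonempty? (e ∩ (⁅ v ⁆ ∪ ⁅ w ⁆))
∈-identifyEdge⁻ {v = v} {w} {e} zero here | yes (x , x∈) with x∈p∩q⁻ e _ x∈
... | x∈e , x∈vw = x , x∈e , collapse-∈ x∈vw
∈-identifyEdge⁻ {e = e} (suc x) (there x∈) =
  x , x∈p─q⇒x∈p x∈ , collapse-∉ (x∈p─q⇒x∉q {p = e} x∈)

module _ {g : Fin (suc n) → Fin k} where

  identifyEdge-polychromatic⁺ :
    Polychromatic (g ∘ collapse v w) e → Polychromatic g (identifyEdge v w e)
  identifyEdge-polychromatic⁺ (x , y , x∈e , y∈e , gx≢gy) =
    _ , _ , ∈-identifyEdge⁺ x∈e , ∈-identifyEdge⁺ y∈e , gx≢gy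

  identifyEdge-polychromatic⁻ :
    Polychromatic g (identifyEdge v w e) → Polychromatic (g ∘ collapse v w) e
  identifyEdge-polychromatic⁻ (x , y , x∈ , y∈ , gx≢gy)
    with ∈-identifyEdge⁻ x x∈ | ∈-identifyEdge⁻ y y∈
  ... | x′ , x′∈e , refl | y′ , y′∈e , refl = x′ , y′ , x′∈e , y′∈e , gx≢gy

-- Such an edge has a vertex outside the pair, and `collapse` keeps that vertex apart from every
-- other one.
2≤∣identifyEdge∣ : 2 ≤ ∣ e ∣ → e ≢ ⁅ v ⁆ ∪ ⁅ w ⁆ → 2 ≤ ∣ identifyEdge v w e ∣
2≤∣identifyEdge∣ {e = e} {v} {w} 2≤e e≢vw with ⊈⇒∃ (e≢vw ∘ ⊆pair⇒≡ 2≤e)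
... | x , x∈e , x∉vw with ∃-other 2≤e x
...   | y , y∈e , y≢x =
  distinct⇒2≤ (∈-identifyEdge⁺ x∈e) (∈-identifyEdge⁺ y∈e) distinct
  where
  distinct : collapse v w x ≢ collapse v w y
  distinct rewrite collapse-∉ x∉vw with y ∈? ⁅ v ⁆ ∪ ⁅ w ⁆
  ... | yes _ = λ ()
  ... | no _  = λ sx≡sy → y≢x (sym (suc-injective sx≡sy))

-- If `f` gives `v` and `w` the same color, this is `f` factored through `collapse v w`. Otherwise
-- the color of the new vertex is a placeholder, good only for edges that avoid it.
descend : (v : Fin n) → (Fin n → Fin k) → Fin (suc n) → Fin k
descend v f zero    = f v
descend v f (suc x) = f x

descend-collapse : {f : Fin n → Fin k} → f v ≡ f w → ∀ x →
  f x ≡ descend v f (collapse v w x)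
descend-collapse {v = v} {w} fv≡fw x with x ∈? ⁅ v ⁆ ∪ ⁅ w ⁆
... | no _ = refl
... | yes x∈ with ∈⁅v,w⁆⇒≡ x∈
...   | inj₁ refl = refl
...   | inj₂ refl = sym fv≡fw

identifyEdge-polychromatic-∌ : {f : Fin n → Fin k} → zero ∉ identifyEdge v w e →
  Polychromatic f e → Polychromatic (descend u f) (identifyEdge v w e)
identifyEdge-polychromatic-∌ {v = v} {w} {e} {u} {f} v*∉ poly =
  identifyEdge-polychromatic⁺ (Polychromatic-≗ f≗ poly)
  where
  f≗ : ∀ {x} → x ∈ e → f x ≡ descend u f (collapse v w x)
  f≗ {x} x∈e with ∈-identifyEdge⁺ {v = v} {w} x∈e
  ... | cx∈ with x ∈? ⁅ v ⁆ ∪ ⁅ w ⁆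
  ...   | yes _ = contradiction cx∈ v*∉
  ...   | no _  = refl

x∈tail⁺ : {p : Subset (suc n)} → suc x ∈ p → x ∈ tail p
x∈tail⁺ (there x∈) = x∈

x∈tail⁻ : {p : Subset (suc n)} → x ∈ tail p → suc x ∈ p
x∈tail⁻ {p = _ ∷ _} x∈ = there x∈

polychromatic-pair : {f : Fin n → Fin k} → Polychromatic f (⁅ v ⁆ ∪ ⁅ w ⁆) → f v ≢ f w
polychromatic-pair (x , y , x∈ , y∈ , fx≢fy) fv≡fw with ∈⁅v,w⁆⇒≡ x∈ | ∈⁅v,w⁆⇒≡ y∈
... | inj₁ refl | inj₁ refl = fx≢fy refl
... | inj₁ refl | inj₂ refl = fx≢fy fv≡fw
... | inj₂ refl | inj₁ refl = fx≢fy (sym fv≡fw)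
... | inj₂ refl | inj₂ refl = fx≢fy refl

-- Vertex deletion and the two sides of a separation

module _ (G : Hypergraph n) (sub : ∀ H → H ⊂ᴴ G → Colorable H k) where

  vertex-deleted-coloring : x ∈ V G →
    Σ[ f ∈ (Fin n → Fin k) ] (∀ e → E G e → x ∉ e → Polychromatic f e)
  vertex-deleted-coloring {x = x} x∈V = let f , colors = sub (G [ V G - x ]) proper in
    f , λ e Ge x∉e → colors e (Ge ,
      λ y∈e → x∈p∧x≢y⇒x∈p-y (E⊆V G Ge y∈e) λ y≡x → x∉e (subst (_∈ e) y≡x y∈e))
    where
    proper : G [ V G - x ] ⊂ᴴ G
    proper = (x∈p─q⇒x∈p , proj₁) ,
      λ (V⊆ , _) → x∈p─q⇒x∉q {p = V G} (V⊆ x∈V) (x∈⁅x⁆ x)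

-- The sides of a separating set S, without S itself.
record Separation (G : Hypergraph n) (S : Subset n) : Set where
  field
    A B   : Subset n
    S⊆V   : S ⊆ V G
    A⊆V   : A ⊆ V G
    B⊆V   : B ⊆ V G
    V⊆    : x ∈ V G → x ∈ A ⊎ x ∈ B ⊎ x ∈ S
    edges : E G e → e ⊆ A ∪ S ⊎ e ⊆ B ∪ S
    A∌S   : x ∈ A → x ∉ S
    B∌S   : x ∈ B → x ∉ S
    A∌B   : x ∈ A → x ∉ B
    A≢∅   : Nonempty A
    B≢∅   : Nonempty B

reverse : {G : Hypergraph n} {S : Subset n} → Separation G S → Separation G S
reverse sep = record
  { A = B ; B = A ; S⊆V = S⊆V ; A⊆V = B⊆V ; B⊆V = A⊆V
  ; V⊆ = λ x∈V → [ inj₂ ∘ inj₁ , [ inj₁ , inj₂ ∘ inj₂ ]′ ]′ (V⊆ x∈V)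
  ; edges = swap ∘ edges
  ; A∌S = B∌S ; B∌S = A∌S ; A∌B = λ x∈B x∈A → A∌B x∈A x∈B ; A≢∅ = B≢∅ ; B≢∅ = A≢∅
  }
  where open Separation sep

separating⇒separation : {G : Hypergraph n} {S : Subset n} →
  S ⊆ V G → IsSeparating G S → Separation G S
separating⇒separation {G = G} {S} S⊆V
  (X₁ , X₂ , X₁⊆V , X₂⊆V , ((V⊆ , E⊆) , _) , refl , S<X₁ , S<X₂) = record
  { A = X₁ ─ S ; B = X₂ ─ S ; S⊆V = S⊆V
  ; A⊆V = X₁⊆V ∘ x∈p─q⇒x∈p ; B⊆V = X₂⊆V ∘ x∈p─q⇒x∈p
  ; V⊆ = V⊆′
  ; edges = edges′
  ; A∌S = x∈p─q⇒x∉q {p = X₁} ; B∌S = x∈p─q⇒x∉q {p = X₂}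
  ; A∌B = λ x∈A x∈B → x∈p─q⇒x∉q {p = X₁} x∈A (x∈p∩q⁺ (x∈p─q⇒x∈p x∈A , x∈p─q⇒x∈p x∈B))
  ; A≢∅ = nonempty S<X₁ ; B≢∅ = nonempty S<X₂
  }
  where
  split : x ∈ p → x ∈ (p ─ S) ∪ S
  split {x = x} {p} x∈p with x ∈? S
  ... | yes x∈S = q⊆p∪q (p ─ S) S x∈S
  ... | no x∉S  = p⊆p∪q S (x∈p∧x∉q⇒x∈p─q x∈p x∉S)
  edges′ : E G e → e ⊆ (X₁ ─ S) ∪ S ⊎ e ⊆ (X₂ ─ S) ∪ S
  edges′ Ge with E⊆ Ge
  ... | inj₁ (_ , e⊆) = inj₁ (split ∘ e⊆)
  ... | inj₂ (_ , e⊆) = inj₂ (split ∘ e⊆)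
  V⊆′ : x ∈ V G → x ∈ X₁ ─ S ⊎ x ∈ X₂ ─ S ⊎ x ∈ S
  V⊆′ {x = x} x∈V with x ∈? S | x∈p∪q⁻ X₁ X₂ (V⊆ x∈V)
  ... | yes x∈S | _          = inj₂ (inj₂ x∈S)
  ... | no x∉S  | inj₁ x∈X₁ = inj₁ (x∈p∧x∉q⇒x∈p─q x∈X₁ x∉S)
  ... | no x∉S  | inj₂ x∈X₂ = inj₂ (inj₁ (x∈p∧x∉q⇒x∈p─q x∈X₂ x∉S))
  nonempty : ∣ S ∣ < ∣ p ∣ → Nonempty (p ─ S)
  nonempty S<p = let x , x∈p , x∉S = ∣p∣<∣q∣⇒∃ S<p in x , x∈p∧x∉q⇒x∈p─q x∈p x∉S

module Sides {G : Hypergraph n} {S : Subset n} (sep : Separation G S) where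
  open Separation sep

  B∩A∪S : x ∈ B → x ∉ A ∪ S
  B∩A∪S x∈B x∈ with x∈p∪q⁻ A S x∈
  ... | inj₁ x∈A = A∌B x∈A x∈B
  ... | inj₂ x∈S = B∌S x∈B x∈S

  A∩B∪S : x ∈ A → x ∉ B ∪ S
  A∩B∪S x∈A x∈ with x∈p∪q⁻ B S x∈
  ... | inj₁ x∈B = A∌B x∈A x∈B
  ... | inj₂ x∈S = A∌S x∈A x∈S

  -- No edge within `A ∪ S` contains a given vertex of `B`, so it survives the deletion of that
  -- vertex.
  side-coloring : (∀ H → H ⊂ᴴ G → Colorable H k) → Colorable (G [ A ∪ S ]) k
  side-coloring sub =
    let b , b∈B = B≢∅
        f , colors = vertex-deleted-coloring G sub (B⊆V b∈B)
    in f , λ e (Ge , e⊆) → colors e Ge λ b∈e → B∩A∪S b∈B (e⊆ b∈e)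

  -- Merging along `B`: an edge within `A ∪ S` avoids `B`, and any other lies in `B ∪ S`. The case
  -- `v ≡ w` is allowed and serves for sets `S` with at most one element.
  merge-sides : {f g : Fin n → Fin k} → S ⊆ ⁅ v ⁆ ∪ ⁅ w ⁆ → f v ≡ f w ⇔ g v ≡ g w →
    Colors (G [ A ∪ S ]) f → Colors (G [ B ∪ S ]) g → Colorable G k
  merge-sides {v = v} {w} {f} {g} S⊆vw f⇔g f-colors g-colors = merge G B f⇔g colors
    where
    colors : ∀ e → E G e →
      ((∀ {x} → x ∈ e → x ∉ B) × Polychromatic f e) ⊎
      ((∀ {x} → x ∈ e → x ∈ B ⊎ x ∈ ⁅ v ⁆ ∪ ⁅ w ⁆) × Polychromatic g e)
    colors e Ge with edges Ge
    ... | inj₁ e⊆ = inj₁ ((λ x∈e x∈B → B∩A∪S x∈B (e⊆ x∈e)) , f-colors e (Ge , e⊆))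
    ... | inj₂ e⊆ = inj₂ (Sum.map₂ S⊆vw ∘ x∈p∪q⁻ B S ∘ e⊆ , g-colors e (Ge , e⊆))

  -- The components of `G ÷ S`

  A⊆V─S : A ⊆ V G ─ S
  A⊆V─S x∈A = x∈p∧x∉q⇒x∈p─q (A⊆V x∈A) (A∌S x∈A)

  ∪S─S : e ⊆ p ∪ S → e ∩ (V G ─ S) ⊆ p
  ∪S─S {e} {p} e⊆ x∈ with x∈p∩q⁻ e (V G ─ S) x∈
  ... | x∈e , x∈V─S with x∈p∪q⁻ p S (e⊆ x∈e)
  ...   | inj₁ x∈p = x∈p
  ...   | inj₂ x∈S = contradiction x∈S (x∈p─q⇒x∉q {p = V G} x∈V─S)

  -- If C splits A, delete a vertex of A on either side of C; both colorings
  -- then color B ∪ S, so they agree on whether v and w have the same color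
  -- and can be merged.
  side-connected : S ⊆ ⁅ v ⁆ ∪ ⁅ w ⁆ → ¬ Colorable G k → (∀ H → H ⊂ᴴ G → Colorable H k) →
    (∀ {f g : Fin n → Fin k} → Colors (G [ B ∪ S ]) f → Colors (G [ B ∪ S ]) g →
      f v ≡ f w ⇔ g v ≡ g w) →
    Connected ((G ÷ S) [ A ])
  side-connected {v} {w} {k} S⊆vw ¬colorable sub same-type = connected _ closed⇒⊇
    where
    closed⇒⊇ : ∀ C {y} → Closed ((G ÷ S) [ A ]) C → y ∈ A → y ∈ C → A ⊆ C
    closed⇒⊇ C {y} closed y∈A y∈C {z} z∈A = decidable-stable (z ∈? C) λ z∉C →
      let f , f-colors = vertex-deleted-coloring G sub (A⊆V z∈A)
          g , g-colors = vertex-deleted-coloring G sub (A⊆V y∈A)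
      -- The map `f` can fail only on edges through `z`, which lies in `A ─ C`, where `g` is used;
      -- `g` can fail only on edges through `y`, which lies outside `A ─ C`, where `f` is used.
      in ¬colorable (merge G (A ─ C)
        (same-type (λ e (Ge , e⊆) → f-colors e Ge λ z∈e → A∩B∪S z∈A (e⊆ z∈e))
                   (λ e (Ge , e⊆) → g-colors e Ge λ y∈e → A∩B∪S y∈A (e⊆ y∈e)))
        (colors z∉C f-colors g-colors))
      where
      -- Two distinct vertices of `e` in `A` make the trace of `e` an edge of `G ÷ S` inside `A`,
      -- which cannot leave the closed set `C`. Equal vertices are split off because a trace with
      -- one element is not an edge.
      spread : E G e → e ⊆ A ∪ S → u ∈ e → u ∈ A → u ∈ C → x ∈ e → x ∈ A → x ∈ C
      spread {e} {u} {x} Ge e⊆ u∈e u∈A u∈C x∈e x∈A with u ≟ x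
      ... | yes refl = u∈C
      ... | no u≢x = closed (e ∩ (V G ─ S))
        (((e , Ge , refl) , distinct⇒2≤ u∈ x∈ u≢x) , ∪S─S e⊆)
        (u , x∈p∩q⁺ (u∈ , u∈C)) x∈
        where
        u∈ : u ∈ e ∩ (V G ─ S)
        u∈ = x∈p∩q⁺ (u∈e , A⊆V─S u∈A)
        x∈ : x ∈ e ∩ (V G ─ S)
        x∈ = x∈p∩q⁺ (x∈e , A⊆V─S x∈A)
      colors : z ∉ C → {f g : Fin n → Fin k} →
        (∀ e → E G e → z ∉ e → Polychromatic f e) →
        (∀ e → E G e → y ∉ e → Polychromatic g e) → ∀ e → E G e →
        ((∀ {x} → x ∈ e → x ∉ A ─ C) × Polychromatic f e) ⊎
        ((∀ {x} → x ∈ e → x ∈ A ─ C ⊎ x ∈ ⁅ v ⁆ ∪ ⁅ w ⁆) × Polychromatic g e)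
      colors z∉C f-colors g-colors e Ge with edges Ge
      ... | inj₂ e⊆ = inj₁
        ( (λ x∈e x∈A─C → A∩B∪S (x∈p─q⇒x∈p x∈A─C) (e⊆ x∈e))
        , f-colors e Ge λ z∈e → A∩B∪S z∈A (e⊆ z∈e))
      -- Either the part of `e` in `A` misses `C`, or it lies in `C` by `spread`.
      ... | inj₁ e⊆ with nonempty? (e ∩ (A ∩ C))
      ...   | no ¬meets = inj₂ (e⊆D∪vw , g-colors e Ge λ y∈e → e∩A∌C y∈e y∈A y∈C)
        where
        e∩A∌C : x ∈ e → x ∈ A → x ∉ C
        e∩A∌C x∈e x∈A x∈C = ¬meets (_ , x∈p∩q⁺ (x∈e , x∈p∩q⁺ (x∈A , x∈C)))
        e⊆D∪vw : x ∈ e → x ∈ A ─ C ⊎ x ∈ ⁅ v ⁆ ∪ ⁅ w ⁆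
        e⊆D∪vw x∈e with x∈p∪q⁻ A S (e⊆ x∈e)
        ... | inj₁ x∈A = inj₁ (x∈p∧x∉q⇒x∈p─q x∈A (e∩A∌C x∈e x∈A))
        ... | inj₂ x∈S = inj₂ (S⊆vw x∈S)
      ...   | yes (u , u∈) with x∈p∩q⁻ e (A ∩ C) u∈
      ...     | u∈e , u∈A∩C with x∈p∩q⁻ A C u∈A∩C
      ...       | u∈A , u∈C = inj₁
        ( (λ x∈e x∈A─C → x∈p─q⇒x∉q {p = A} x∈A─C (e∩A⊆C x∈e (x∈p─q⇒x∈p x∈A─C)))
        , f-colors e Ge λ z∈e → z∉C (e∩A⊆C z∈e z∈A))
        where
        e∩A⊆C : x ∈ e → x ∈ A → x ∈ C
        e∩A⊆C = spread Ge e⊆ u∈e u∈A u∈C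

  ÷-edge : E (G ÷ S) e → e ⊆ A ⊎ e ⊆ B
  ÷-edge ((e , Ge , refl) , _) with edges Ge
  ... | inj₁ e⊆ = inj₁ (∪S─S e⊆)
  ... | inj₂ e⊆ = inj₂ (∪S─S e⊆)

  module _ {H : Hypergraph n} (H⊆ : H ⊆ᴴ G ÷ S) where

    walk-stays : ∀ {vs es} → Walk H x y vs es → x ∈ A → y ∈ A
    walk-stays (stop _) x∈A = x∈A
    walk-stays (step He x∈e y∈e walk) x∈A with ÷-edge (proj₂ H⊆ He)
    ... | inj₁ e⊆A = walk-stays walk (e⊆A y∈e)
    ... | inj₂ e⊆B = contradiction (e⊆B x∈e) (A∌B x∈A)

    connected⇒⊆side : Connected H → x ∈ V H → x ∈ A → H ⊆ᴴ (G ÷ S) [ A ]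
    connected⇒⊆side conn x∈H x∈A = V⊆A , λ He →
      proj₂ H⊆ He , λ z∈e → V⊆A (E⊆V H He z∈e)
      where
      V⊆A : V H ⊆ A
      V⊆A y∈H = let _ , _ , walk , _ = conn x∈H y∈H in walk-stays walk x∈A

  -- A connected subhypergraph containing this side meets `A`, and its walks cannot leave `A`, since
  -- no edge of `G ÷ S` joins `A` to `B`.
  isComponent : Connected ((G ÷ S) [ A ]) → IsComponent (G ÷ S) ((G ÷ S) [ A ])
  isComponent conn = (A⊆V─S , proj₁) , conn , λ H′ H′⊆ conn′ (A⊆H′ , _) →
    let a , a∈A = A≢∅ in connected⇒⊆side H′⊆ conn′ (A⊆H′ a∈A) a∈A

hasExactlyComponents : {G : Hypergraph n} {S : Subset n} (sep : Separation G S) →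
  let open Separation sep in
  Connected ((G ÷ S) [ A ]) → Connected ((G ÷ S) [ B ]) →
  HasExactlyComponents (G ÷ S) ((G ÷ S) [ A ]) ((G ÷ S) [ B ])
hasExactlyComponents {G = G} {S} sep connA connB =
  componentA , componentB ,
  (λ ((A⊆B , _) , _) → let a , a∈A = A≢∅ in A∌B a∈A (A⊆B a∈A)) ,
  exhaustive
  where
  open Separation sep
  module SA = Sides sep
  module SB = Sides (reverse sep)
  componentA : IsComponent (G ÷ S) ((G ÷ S) [ A ])
  componentA = SA.isComponent connA
  componentB : IsComponent (G ÷ S) ((G ÷ S) [ B ])
  componentB = SB.isComponent connB
  exhaustive : ∀ H → IsComponent (G ÷ S) H → H ≈ᴴ (G ÷ S) [ A ] ⊎ H ≈ᴴ (G ÷ S) [ B ]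
  exhaustive H (H⊆ , conn , maximal) with nonempty? (V H)
  -- A hypergraph without vertices is connected by definition, but not maximal: it is contained in
  -- the side of `A`, which has a vertex.
  ... | no ¬x = contradiction
    (let a , a∈A = A≢∅ in
      a , proj₁ (maximal _ (proj₁ componentA) connA
        ( (λ x∈H → contradiction (_ , x∈H) ¬x)
        , λ He → contradiction
            (let x , x∈e , _ = ∃-other (2≤E H He) a in x , E⊆V H He x∈e) ¬x)) a∈A)
    ¬x
  ... | yes (x , x∈H) with V⊆ (x∈p─q⇒x∈p (proj₁ H⊆ x∈H))
  ...   | inj₁ x∈A =
    let H⊆A = SA.connected⇒⊆side H⊆ conn x∈H x∈A
    in inj₁ (H⊆A , maximal _ (proj₁ componentA) connA H⊆A)
  ...   | inj₂ (inj₁ x∈B) =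
    let H⊆B = SB.connected⇒⊆side H⊆ conn x∈H x∈B
    in inj₂ (H⊆B , maximal _ (proj₁ componentB) connB H⊆B)
  ...   | inj₂ (inj₂ x∈S) = contradiction x∈S (x∈p─q⇒x∉q {p = V G} (proj₁ H⊆ x∈H))

-- Criticality of the two hypergraphs built from the sides

module Critical {G : Hypergraph n}
  (¬colorable : ¬ Colorable G (suc m))
  (sub : ∀ H → H ⊂ᴴ G → Colorable H (suc m))
  (v≢w : v ≢ w)
  (sep : Separation G (⁅ v ⁆ ∪ ⁅ w ⁆))
  {f g : Fin n → Fin (suc m)}
  (f-colors : Colors (G [ Separation.A sep ∪ (⁅ v ⁆ ∪ ⁅ w ⁆) ]) f) (fv≡fw : f v ≡ f w)
  (g-colors : Colors (G [ Separation.B sep ∪ (⁅ v ⁆ ∪ ⁅ w ⁆) ]) g) (gv≢gw : g v ≢ g w)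
  where

  open Separation sep
  open Sides sep using (merge-sides; A∩B∪S; B∩A∪S; side-connected)

  S : Subset n
  S = ⁅ v ⁆ ∪ ⁅ w ⁆

  G₁ G₂ G₁+vw G₂/vw : Hypergraph _
  G₁ = G [ A ∪ S ]
  G₂ = G [ B ∪ S ]
  G₁+vw = addEdge G₁ v w v≢w
  G₂/vw = identify G₂ v w

  S⊆A∪S : S ⊆ A ∪ S
  S⊆A∪S = q⊆p∪q A S

  S⊆B∪S : S ⊆ B ∪ S
  S⊆B∪S = q⊆p∪q B S

  -- A coloring of `G₁` that separates `v` and `w` would merge with the given `g` to a coloring of
  -- `G`.
  same : {f : Fin n → Fin (suc m)} → Colors G₁ f → f v ≡ f w
  same {f = f} f-colors = decidable-stable (f v ≟ f w) λ fv≢fw → ¬colorable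
    (merge-sides ⊆-refl
      (mk⇔ (λ fv≡fw → contradiction fv≡fw fv≢fw) (λ gv≡gw → contradiction gv≡gw gv≢gw))
      f-colors g-colors)

  -- A coloring of `G₂` that identifies `v` and `w` would merge with the given `f`.
  different : {g : Fin n → Fin (suc m)} → Colors G₂ g → g v ≢ g w
  different g-colors gv≡gw = ¬colorable
    (merge-sides ⊆-refl (mk⇔ (λ _ → gv≡gw) (λ _ → fv≡fw)) f-colors g-colors)

  S∉E : ¬ E G S
  S∉E GS = polychromatic-pair (f-colors S (GS , S⊆A∪S)) fv≡fw

  E⇒≢S : E G e → e ≢ S
  E⇒≢S Ge refl = S∉E Ge

  -- The two sides meet only in `S`, so such an edge would be `S` itself. This tells from which side
  -- an edge of the hypergraphs `H′` below comes.
  ¬both-sides : E G e → e ⊆ A ∪ S → ¬ e ⊆ B ∪ S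
  ¬both-sides {e} Ge e⊆A∪S e⊆B∪S = E⇒≢S Ge (⊆pair⇒≡ (2≤E G Ge) e⊆S)
    where
    e⊆S : e ⊆ S
    e⊆S x∈e with x∈p∪q⁻ A S (e⊆A∪S x∈e)
    ... | inj₁ x∈A = contradiction (e⊆B∪S x∈e) (A∩B∪S x∈A)
    ... | inj₂ x∈S = x∈S

  -- All colorings of `G₂` separate `v` and `w`, so any two of them agree in this respect; for the
  -- other side, all colorings of `G₁` identify them.
  connected-A : Connected ((G ÷ S) [ A ])
  connected-A = side-connected ⊆-refl ¬colorable sub λ g₁ g₂ →
    mk⇔ (λ eq → contradiction eq (different g₁)) (λ eq → contradiction eq (different g₂))

  connected-B : Connected ((G ÷ S) [ B ])
  connected-B = Sides.side-connected (reverse sep) ⊆-refl ¬colorable sub λ f₁ f₂ →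
    mk⇔ (λ _ → same f₂) (λ _ → same f₁)

  A∪S⊆V : A ∪ S ⊆ V G
  A∪S⊆V x∈ = [ A⊆V , S⊆V ]′ (x∈p∪q⁻ A S x∈)

  B∪S⊆V : B ∪ S ⊆ V G
  B∪S⊆V x∈ = [ B⊆V , S⊆V ]′ (x∈p∪q⁻ B S x∈)

  -- The map `f` fails only on the edge `vw`, which a new color for `v` repairs. Without a new
  -- color, a coloring would restrict to one of `G₁` that separates `v` and `w`.
  addEdge-critical : [ suc m +1]-Critical G₁+vw
  addEdge-critical = critical G₁+vw (colorable-suc G₁+vw v f away-from-v)
    (λ (h , h-colors) → polychromatic-pair (h-colors S (inj₂ refl))
      (same λ e G₁e → h-colors e (inj₁ G₁e)))
    proper⇒colorable
    where
    away-from-v : ∀ e → E G₁+vw e → v ∉ e → Polychromatic f e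
    away-from-v e (inj₁ G₁e)  _   = f-colors e G₁e
    away-from-v _ (inj₂ refl) v∉S = contradiction v∈⁅v,w⁆ v∉S

    -- If vw is an edge of H, replacing it by G₂ gives a proper subhypergraph
    -- of G, whose coloring separates v and w on account of G₂.
    module _ (H : Hypergraph n) (H⊂ : H ⊂ᴴ G₁+vw) (HS : E H S) where

      H⊆V : V H ⊆ V G
      H⊆V x∈H with x∈p∪q⁻ (A ∪ S) S (proj₁ (proj₁ H⊂) x∈H)
      ... | inj₁ x∈A∪S = A∪S⊆V x∈A∪S
      ... | inj₂ x∈S   = S⊆V x∈S

      H′ : Hypergraph n
      H′ = record
        { V   = V H ∪ (B ∪ S)
        -- The condition `E G e` drops `vw`, which is an edge of `H` but not of `G`.
        ; E   = λ e → E G e × (E H e ⊎ e ⊆ B ∪ S)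
        ; E?  = λ e → E? G e ×-dec (E? H e ⊎-dec e ⊆? B ∪ S)
        ; E⊆V = λ { (_ , inj₁ He) x∈e → p⊆p∪q (B ∪ S) (E⊆V H He x∈e)
                  ; (_ , inj₂ e⊆) x∈e → q⊆p∪q (V H) (B ∪ S) (e⊆ x∈e) }
        ; 2≤E = λ (Ge , _) → 2≤E G Ge
        }

      H′⊂G : H′ ⊂ᴴ G
      H′⊂G = ((λ x∈ → [ H⊆V , B∪S⊆V ]′ (x∈p∪q⁻ (V H) (B ∪ S) x∈)) , proj₁) , G⊈H′
        where
        G⊈H′ : ¬ G ⊆ᴴ H′
        -- If `H′` were all of `G`, then `H` would be all of `G₁+vw`, because vertices of `A` and
        -- edges within `A ∪ S` can enter `H′` only from `H`.
        G⊈H′ (V⊆H′ , E⊆H′) = proj₂ H⊂ (V⊆H , E⊆H)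
          where
          A∪S⊆H : A ∪ S ⊆ V H
          A∪S⊆H x∈ with x∈p∪q⁻ A S x∈
          ... | inj₂ x∈S = E⊆V H HS x∈S
          ... | inj₁ x∈A with x∈p∪q⁻ (V H) (B ∪ S) (V⊆H′ (A⊆V x∈A))
          ...   | inj₁ x∈H   = x∈H
          ...   | inj₂ x∈B∪S = contradiction x∈B∪S (A∩B∪S x∈A)
          V⊆H : (A ∪ S) ∪ S ⊆ V H
          V⊆H x∈ = [ A∪S⊆H , E⊆V H HS ]′ (x∈p∪q⁻ (A ∪ S) S x∈)
          E⊆H : E G₁+vw e → E H e
          E⊆H (inj₂ refl) = HS
          E⊆H (inj₁ (Ge , e⊆A∪S)) with E⊆H′ Ge
          ... | _ , inj₁ He    = He
          ... | _ , inj₂ e⊆B∪S = ⊥-elim (¬both-sides Ge e⊆A∪S e⊆B∪S)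

      with-S : Colorable H (suc m)
      with-S = let h , h-colors = sub H′ H′⊂G in h , λ e He →
        H-colors h-colors He (proj₂ (proj₁ H⊂) He)
        where
        H-colors : {h : Fin n → Fin (suc m)} → Colors H′ h →
          E H e → E G₁+vw e → Polychromatic h e
        H-colors h-colors He (inj₁ (Ge , _)) = h-colors _ (Ge , inj₁ He)
        H-colors h-colors He (inj₂ refl) = v , w , v∈⁅v,w⁆ , w∈⁅v,w⁆ ,
          different λ e (Ge , e⊆) → h-colors e (Ge , inj₂ e⊆)

    proper⇒colorable : ∀ H → H ⊂ᴴ G₁+vw → Colorable H (suc m)
    proper⇒colorable H H⊂ with E? H S
    ... | yes HS = with-S H H⊂ HS
    ... | no ¬HS = f , λ e He → H-colors He (proj₂ (proj₁ H⊂) He)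
      where
      H-colors : E H e → E G₁+vw e → Polychromatic f e
      H-colors He (inj₁ G₁e)  = f-colors _ G₁e
      H-colors He (inj₂ refl) = contradiction He ¬HS

  -- A new color for the new vertex settles every edge through it, and `g` colors the others.
  -- Without a new color, a coloring pulled back along `collapse` would color `G₂` with `v` and `w`
  -- alike; no edge of `G₂` is lost, since `S` is not an edge.
  identify-critical : [ suc m +1]-Critical G₂/vw
  identify-critical = critical G₂/vw
    (colorable-suc G₂/vw zero (descend v g) away-from-v*)
    (λ (h , h-colors) → different
      (λ e G₂e@(Ge , _) → identifyEdge-polychromatic⁻ (h-colors _
        ((e , G₂e , refl) , 2≤∣identifyEdge∣ (2≤E G Ge) (E⇒≢S Ge))))
      (cong h (trans (collapse-∈ (v∈⁅v,w⁆ {v = v})) (sym (collapse-∈ (w∈⁅v,w⁆ {w = w}))))))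
    proper⇒colorable
    where
    away-from-v* : ∀ e → E G₂/vw e → zero ∉ e → Polychromatic (descend v g) e
    away-from-v* _ ((e , G₂e , refl) , _) v*∉ =
      identifyEdge-polychromatic-∌ v*∉ (g-colors e G₂e)

    -- If v* is a vertex of H, replacing it by G₁ gives a proper subhypergraph
    -- of G, whose coloring identifies the colors of v and w on account of G₁.
    module _ (H : Hypergraph (suc n)) (H⊂ : H ⊂ᴴ G₂/vw) (v*∈H : zero ∈ V H) where

      tail⊆V : tail (V H) ⊆ V G
      tail⊆V x∈ with proj₁ (proj₁ H⊂) (x∈tail⁻ x∈)
      ... | there x∈′ = B∪S⊆V (x∈p─q⇒x∈p x∈′)

      H′ : Hypergraph n
      H′ = record
        { V   = (A ∪ S) ∪ tail (V H)
        -- Several edges may have the same image, and all those with an image in `H` are taken.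
        ; E   = λ e → E G e × (e ⊆ A ∪ S ⊎ E H (identifyEdge v w e))
        ; E?  = λ e → E? G e ×-dec (e ⊆? A ∪ S ⊎-dec E? H (identifyEdge v w e))
        ; E⊆V = E⊆V′
        ; 2≤E = λ (Ge , _) → 2≤E G Ge
        }
        where
        E⊆V′ : E G e × (e ⊆ A ∪ S ⊎ E H (identifyEdge v w e)) → e ⊆ (A ∪ S) ∪ tail (V H)
        E⊆V′ (_ , inj₁ e⊆) x∈e = p⊆p∪q (tail (V H)) (e⊆ x∈e)
        E⊆V′ (_ , inj₂ He) {x} x∈e with x ∈? S
        ... | yes x∈S = p⊆p∪q (tail (V H)) (S⊆A∪S x∈S)
        ... | no x∉S  = q⊆p∪q (A ∪ S) (tail (V H))
          (x∈tail⁺ (subst (_∈ V H) (collapse-∉ x∉S) (E⊆V H He (∈-identifyEdge⁺ x∈e))))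

      H′⊂G : H′ ⊂ᴴ G
      H′⊂G = ((λ x∈ → [ A∪S⊆V , tail⊆V ]′ (x∈p∪q⁻ (A ∪ S) (tail (V H)) x∈)) , proj₁) , G⊈H′
        where
        G⊈H′ : ¬ G ⊆ᴴ H′
        G⊈H′ (V⊆H′ , E⊆H′) = proj₂ H⊂ (V⊆H , E⊆H)
          where
          V⊆H : V G₂/vw ⊆ V H
          V⊆H here = v*∈H
          V⊆H (there x∈) with x∈p∪q⁻ B S (x∈p─q⇒x∈p x∈)
          ... | inj₂ x∈S = contradiction x∈S (x∈p─q⇒x∉q {p = B ∪ S} x∈)
          ... | inj₁ x∈B with x∈p∪q⁻ (A ∪ S) (tail (V H)) (V⊆H′ (B⊆V x∈B))
          ...   | inj₁ x∈A∪S = contradiction x∈A∪S (B∩A∪S x∈B)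
          ...   | inj₂ x∈H   = x∈tail⁻ x∈H
          E⊆H : E G₂/vw e → E H e
          E⊆H ((e , (Ge , e⊆B∪S) , refl) , _) with E⊆H′ Ge
          ... | _ , inj₁ e⊆A∪S = ⊥-elim (¬both-sides Ge e⊆A∪S e⊆B∪S)
          ... | _ , inj₂ He    = He

      with-v* : Colorable H (suc m)
      with-v* = let h , h-colors = sub H′ H′⊂G in
        descend v h , λ e He → H-colors h-colors He (proj₂ (proj₁ H⊂) He)
        where
        H-colors : {h : Fin n → Fin (suc m)} → Colors H′ h →
          E H e → E G₂/vw e → Polychromatic (descend v h) e
        H-colors {h = h} h-colors He ((e , (Ge , _) , refl) , _) = identifyEdge-polychromatic⁺
          (Polychromatic-≗ (λ {x} _ → descend-collapse (same G₁-colors) x)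
            (h-colors e (Ge , inj₂ He)))
          where
          G₁-colors : Colors G₁ h
          G₁-colors e (Ge , e⊆) = h-colors e (Ge , inj₁ e⊆)

    proper⇒colorable : ∀ H → H ⊂ᴴ G₂/vw → Colorable H (suc m)
    proper⇒colorable H H⊂ with zero ∈? V H
    ... | yes v*∈H = with-v* H H⊂ v*∈H
    -- No edge of `H` contains the new vertex, so it does not matter that `g` separates `v` and `w`.
    ... | no v*∉H  = descend v g , λ e He →
      away-from-v* e (proj₂ (proj₁ H⊂) He) λ v*∈e → v*∉H (E⊆V H He v*∈e)

  conclusion : Σ[ v≢w ∈ v ≢ w ] (
    S ≡ ⁅ v ⁆ ∪ ⁅ w ⁆ ×
    ¬ E G (⁅ v ⁆ ∪ ⁅ w ⁆) ×
    ∃₂ λ H₁ H₂ → HasExactlyComponents (G ÷ S) H₁ H₂ ×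
      let G₁ = G [ V H₁ ∪ S ]
          G₂ = G [ V H₂ ∪ S ]
      in (Σ[ φ₁ ∈ Coloring G₁ (suc m) ] SameColor G₁ φ₁ v w) ×
         ((φ : Coloring G₁ (suc m)) → SameColor G₁ φ v w) ×
         ((φ : Coloring G₂ (suc m)) → DifferentColors G₂ φ v w) ×
         [ suc m +1]-Critical (addEdge G₁ v w v≢w) ×
         [ suc m +1]-Critical (identify G₂ v w))
  conclusion = v≢w , refl , S∉E , (G ÷ S) [ A ] , (G ÷ S) [ B ] ,
    hasExactlyComponents sep connected-A connected-B ,
    (φ₁ , φ-same φ₁) , φ-same , φ-different , addEdge-critical , identify-critical
    where
    φ₁ : Coloring G₁ (suc m)
    φ₁ = colorable⇒coloring G₁ (f , f-colors)
    φ-same : (φ : Coloring G₁ (suc m)) → SameColor G₁ φ v w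
    φ-same φ = S⊆A∪S v∈⁅v,w⁆ , S⊆A∪S w∈⁅v,w⁆ ,
      trans (sym (extend-≡ G₁ (proj₁ φ) _))
        (trans (same (extend-colors G₁ φ)) (extend-≡ G₁ (proj₁ φ) _))
    φ-different : (φ : Coloring G₂ (suc m)) → DifferentColors G₂ φ v w
    φ-different φ = S⊆B∪S v∈⁅v,w⁆ , S⊆B∪S w∈⁅v,w⁆ ,
      subst₂ _≢_ (extend-≡ G₂ (proj₁ φ) _) (extend-≡ G₂ (proj₁ φ) _)
        (different (extend-colors G₂ φ))

-- Cases by the size of `S` and the colors of `v` and `w`

theorem8 : ∀ {n} (G : Hypergraph n) (k : ℕ) → 2 ≤ k → [ k +1]-Critical G →
    (S : Subset n) → S ⊆ V G → IsSeparating G S → ∣ S ∣ ≤ 2 →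
    ∃₂ λ v w → Σ[ v≢w ∈ v ≢ w ] (
      S ≡ ⁅ v ⁆ ∪ ⁅ w ⁆ ×
      ¬ E G (⁅ v ⁆ ∪ ⁅ w ⁆) ×
      ∃₂ λ H₁ H₂ → HasExactlyComponents (G ÷ S) H₁ H₂ ×
        let G₁ = G [ V H₁ ∪ S ]
            G₂ = G [ V H₂ ∪ S ]
        in (Σ[ φ₁ ∈ Coloring G₁ k ] SameColor G₁ φ₁ v w) ×
           ((φ : Coloring G₁ k) → SameColor G₁ φ v w) ×
           ((φ : Coloring G₂ k) → DifferentColors G₂ φ v w) ×
           [ k +1]-Critical (addEdge G₁ v w v≢w) ×
           [ k +1]-Critical (identify G₂ v w))
theorem8 G (suc m) _ crit S S⊆V separating S≤2
  with sep ← separating⇒separation {G = G} S⊆V separating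
  with (f , f-colors) ← Sides.side-coloring sep (critical⇒sub-colorable G crit)
     | (g , g-colors) ← Sides.side-coloring (reverse sep) (critical⇒sub-colorable G crit)
  with ∣p∣≤2-cases (proj₁ (Separation.A≢∅ sep)) S S≤2
-- With `v` in both places of the pair, the two colorings agree trivially and merge.
... | inj₁ (v , S⊆v) = contradiction
  (Sides.merge-sides sep S⊆v (mk⇔ (λ _ → refl) (λ _ → refl)) f-colors g-colors)
  (critical⇒¬colorable G crit)
-- The side whose coloring identifies `v` and `w` becomes `G₁`, after `reverse` if necessary. If
-- both colorings identify them or both separate them, the colorings merge.
... | inj₂ (v , w , v≢w , refl) with f v ≟ f w | g v ≟ g w
...   | yes fv≡fw | no gv≢gw = v , w , Critical.conclusion
  (critical⇒¬colorable G crit) (critical⇒sub-colorable G crit) v≢w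
  sep f-colors fv≡fw g-colors gv≢gw
...   | no fv≢fw | yes gv≡gw = v , w , Critical.conclusion
  (critical⇒¬colorable G crit) (critical⇒sub-colorable G crit) v≢w
  (reverse sep) g-colors gv≡gw f-colors fv≢fw
...   | yes fv≡fw | yes gv≡gw = contradiction
  (Sides.merge-sides sep ⊆-refl (mk⇔ (λ _ → gv≡gw) (λ _ → fv≡fw)) f-colors g-colors)
  (critical⇒¬colorable G crit)
...   | no fv≢fw | no gv≢gw = contradiction
  (Sides.merge-sides sep ⊆-refl
    (mk⇔ (λ eq → contradiction eq fv≢fw) (λ eq → contradiction eq gv≢gw))
    f-colors g-colors)
  (critical⇒¬colorable G crit)
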